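{- Let $F\colon\mathbb{F}_{2^n}\to\mathbb{F}_{2^m}$ be a Boolean bent function. Then for any $a\in\mathbb{F}_{2^m}$ we have $$|F^{ -1}(a)|=2^{n-m}+2^{n/2}-2^{n/2-m}(2k_a+1),$$ where $k_a=|\{b\in\mathbb{F}_{2^m}^*: W_F(b,0)=-2^{n/2}\cdot(-1)^{\operatorname{Tr}(ab)}\}|$, and all $k_a$ have the same parity.
   Context: $\operatorname{Tr}$ denotes the absolute trace to $\mathbb{F}_2$. The Walsh transform of $F\colon\mathbb{F}_{2^n}\to\mathbb{F}_{2^m}$ is $W_F(b,a)=\sum_{x\in\mathbb{F}_{2^n}}(-1)^{\operatorname{Tr}(bF(x))+\operatorname{Tr}(ax)}$ for $b\in\mathbb{F}_{2^m}$, $a\in\mathbb{F}_{2^n}$. $F$ is bent if $|W_F(b,a)|=2^{n/2}$ for all $b\in\mathbb{F}_{2^m}^*$ and all $a\in\mathbb{F}_{2^n}$. $F^{ -1}(a)$ denotes the preimage set of $a$.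
   Formalization: The claim that all k_a have the same parity is proved only for m ≥ 2; for m = 1 it always fails, since k_0 + k_1 = 1 (e.g. F(x) = x^3 from F_4 to F_2). The preimage formula is proved for every m. -}

module Defs where

open import Algebra.Bundles using (CommutativeRing)
import Algebra.Properties.Semiring.Exp as Exp
import Algebra.Properties.Semiring.Sum as Sum
open import Data.Fin.Base using (Fin; toℕ)
import Data.Fin.Properties as Fin
open import Data.Integer.Base as ℤ using (ℤ; +_; -[1+_]; -_; ∣_∣)
import Data.Integer.Properties as ℤ
open import Data.List.Base using (List; tabulate; filter; length)
open import Data.Nat.Base as ℕ using (ℕ; suc)
import Data.Nat.Properties as ℕ
open import Data.Parity.Base as ℙ using (Parity; 0ℙ; 1ℙ)
open import Data.Product.Base using (∃; _×_)
open import Data.Rational.Base as ℚ using (ℚ)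
open import Function.Bundles using (Func; Inverse)
open import Function.Construct.Symmetry using (inverse)
open import Function.Properties.Inverse using (Inverse⇒Injection)
open import Level using (_⊔_) renaming (suc to lsuc)
open import Relation.Binary.Definitions using (Decidable)
open import Relation.Binary.PropositionalEquality.Core using (_≡_)
import Relation.Binary.PropositionalEquality.Properties as ≡
open import Relation.Nullary.Decidable using (Dec; yes; no; ¬?; _×-dec_; via-injection)
open import Relation.Nullary.Negation using (¬_)
import Relation.Unary as Unary

-- A field with 2ⁿ elements.  Such a field is unique up to isomorphism, so
-- results about 𝔽_{2ⁿ} are stated for an arbitrary one.
record BinaryField c ℓ (n : ℕ) : Set (lsuc (c ⊔ ℓ)) where
  field
    commutativeRing : CommutativeRing c ℓ

  open CommutativeRing commutativeRing public

  field
    0≉1         : ¬ (0# ≈ 1#)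
    invertible  : ∀ x → ¬ (x ≈ 0#) → ∃ λ y → x * y ≈ 1#
    enumeration : Inverse (≡.setoid (Fin (2 ℕ.^ n))) setoid

  open Exp semiring public using (_^_)
  open Sum semiring using (sum)

  element : Fin (2 ℕ.^ n) → Carrier
  element = Inverse.to enumeration

  _≟_ : Decidable _≈_
  _≟_ = via-injection (Inverse⇒Injection (inverse enumeration)) Fin._≟_

  card : ∀ {p} {P : Unary.Pred Carrier p} → Unary.Decidable P → ℕ
  card P? = length (filter P? (tabulate element))

  trace : Carrier → Carrier
  trace x = sum {n} (λ i → x ^ (2 ℕ.^ toℕ i))

  -- The absolute trace with values in the field 𝔽₂ = Parity.  As trace x
  -- equals its own square, it is either 0# or 1#; this only identifies the
  -- prime subfield {0# , 1#} with Parity.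
  Tr : Carrier → Parity
  Tr x with trace x ≟ 0#
  ... | yes _ = 0ℙ
  ... | no  _ = 1ℙ

[-1]^_ : Parity → ℤ
[-1]^ 0ℙ = ℤ.1ℤ
[-1]^ 1ℙ = ℤ.-1ℤ

2^_ : ℤ → ℚ
2^ (+ k)    = + (2 ℕ.^ k) ℚ./ 1
2^ -[1+ k ] = ℚ._/_ (+ 1) (2 ℕ.^ suc k) {{ℕ.m^n≢0 2 (suc k)}}

fromℕ : ℕ → ℚ
fromℕ k = + k ℚ./ 1

module _ {c₁ ℓ₁ c₂ ℓ₂} {n m : ℕ}
         (K : BinaryField c₁ ℓ₁ n) (L : BinaryField c₂ ℓ₂ m)
         where

  private
    module K = BinaryField K
    module L = BinaryField L

  module _ (F : Func K.setoid L.setoid) where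

    open Func F using (to)
    open Sum ℤ.+-*-semiring using (sum)

    Walsh : L.Carrier → K.Carrier → ℤ
    Walsh b a = sum λ i → let x = K.element i in
      [-1]^ (L.Tr (b L.* to x) ℙ.+ K.Tr (a K.* x))

    -- ∣W∣ = 2^{n/2}, where 2^{n/2} is the nonnegative real square root of 2ⁿ
    -- (n is not assumed to be even).
    Bent : Set (c₁ ⊔ c₂ ⊔ ℓ₂)
    Bent = ∀ b → ¬ (b L.≈ L.0#) → ∀ a → ∣ Walsh b a ∣ ℕ.^ 2 ≡ 2 ℕ.^ n

    ∣preimage∣ : L.Carrier → ℕ
    ∣preimage∣ a = K.card (λ x → to x L.≟ a)

    -- k_a, where h stands for n/2.
    k : ℕ → L.Carrier → ℕ
    k h a = L.card {P = λ b → ¬ (b L.≈ L.0#) ×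
                              Walsh b K.0# ≡ - (+ (2 ℕ.^ h)) ℤ.* [-1]^ (L.Tr (a L.* b))}
      (λ b → ¬? (b L.≟ L.0#) ×-dec
             (Walsh b K.0# ℤ.≟ - (+ (2 ℕ.^ h)) ℤ.* [-1]^ (L.Tr (a L.* b))))

{-# OPTIONS --safe #-}
-- Since 2^m |F⁻¹(a)| = Σ_b W_F(b,0) (-1)^{Tr(ab)} and every term with b ≠ 0 is
-- ±2^{n/2}, negative exactly when b is counted by k_a, the formula follows.  This
-- needs Tr ≠ 0 on 𝔽_{2^m}, which bentness itself provides.  Writing the sign of
-- W_F(b,0) as (-1)^{s_b}, k_a ≡ Σ_b s_b + Tr(a Σ_b b) (mod 2), and Σ_b b = 0
-- when m ≥ 2.
module Submission where

open import Defs
open import Algebra.Bundles using (CommutativeMonoid)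
import Algebra.Properties.CommutativeMonoid.Sum as MonoidSum
import Algebra.Properties.CommutativeSemiring.Exp as CommutativeExp
import Algebra.Properties.Group as GroupProperties
import Algebra.Properties.Ring as RingProperties
import Algebra.Properties.Semiring.Mult as SemiringMult
import Algebra.Properties.Semiring.Sum as SemiringSum
open import Data.Bool.Base using (if_then_else_; true; false)
open import Data.Fin.Base as Fin using (Fin; zero; suc; toℕ)
import Data.Fin.Properties as Fin
open import Data.Integer.Base as ℤ using (ℤ; +_; -[1+_]; ∣_∣)
import Data.Integer.Properties as ℤ
import Data.Integer.Solver as ℤ-Solver
open import Data.List.Base using (length; filter; tabulate)
open import Data.Nat.Base as ℕ using (ℕ; zero; suc; _≤_; parity)
open import Data.Nat.Divisibility using (divides)
open import Data.Nat.Primality using (euclidsLemma; prime[2])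
import Data.Nat.Properties as ℕ
import Data.Nat.Solver as ℕ-Solver
open import Data.Parity.Base as ℙ using (Parity; 0ℙ; 1ℙ)
import Data.Parity.Properties as ℙ
open import Data.Product.Base using (∃; Σ; _×_; _,_; proj₁; proj₂)
open import Data.Rational.Base as ℚ using (1ℚ; toℚᵘ)
import Data.Rational.Properties as ℚ
import Data.Rational.Solver as ℚ-Solver
open import Data.Rational.Unnormalised.Base as ℚᵘ using (mkℚᵘ; *≡*)
import Data.Rational.Unnormalised.Properties as ℚᵘ
open import Data.Sum.Base using ([_,_]′)
open import Function.Base using (_∘_; const; id)
open import Function.Bundles using (Func; Inverse)
import Function.Construct.Composition as Composition
import Function.Construct.Symmetry as Symmetry
open import Relation.Binary.PropositionalEquality.Core as ≡ using (_≡_; _≢_)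
import Relation.Binary.PropositionalEquality.Properties as ≡
import Relation.Binary.Reasoning.Setoid as SetoidReasoning
open import Relation.Nullary.Decidable
  using (Dec; does; yes; no; dec-true; dec-false; ¬?; _×-dec_)
open import Relation.Nullary.Negation using (¬_; contradiction)
open import Relation.Unary using (Decidable)

-- The fields are arbitrary ones with 2ⁿ and 2^m elements, so characteristic 2, x^(2ⁿ) = x and the
-- fact that the trace lands in {0, 1} all have to come from the cardinality. One device supplies
-- most of this: a translation or a scaling permutes the field, so a sum or product over all
-- elements is unchanged by it. Evenness of n is a consequence of bentness: |W|² = 2ⁿ with |W| an
-- integer. Since n - m and n/2 - m may be negative, the counting identity is proved in ℕ after
-- multiplication by 2^m, with negative terms moved across, and divided only at the end. The
-- restriction m ≥ 2 in the parity claim is genuine. For m = 1 only b = 1 can be counted, and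
-- (-1)^Tr(ab) takes opposite values at a = 0 and a = 1, so exactly one of k_0, k_1 equals 1.

module _ {a ℓ} (M : CommutativeMonoid a ℓ) where

  open CommutativeMonoid M
  open MonoidSum M using (sum; sum-cong-≋; sum-replicate-zero)

  sum-single : ∀ {n} (i : Fin n) (t : Fin n → Carrier) →
               (∀ j → j ≢ i → t j ≈ ε) → sum t ≈ t i
  sum-single {suc n} zero t t≈ε =
    trans (∙-congˡ (trans (sum-cong-≋ λ j → t≈ε (suc j) λ ()) (sum-replicate-zero n))) (identityʳ _)
  sum-single (suc i) t t≈ε =
    trans (∙-cong (t≈ε zero λ ()) (sum-single i (t ∘ suc) λ j j≢i → t≈ε (suc j) (j≢i ∘ Fin.suc-injective)))
          (identityˡ _)

  -- `h` is an additive map from ℕ, given by its value at 0 and its step `u`. Keeping it abstract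
  -- lets one induction serve for counts scaled by a constant in ℤ and for counts mod 2.
  length-filter-tabulate :
    ∀ (h : ℕ → Carrier) u → h 0 ≈ ε → (∀ k → h (suc k) ≈ u ∙ h k) →
    ∀ {b p} {B : Set b} {P : B → Set p} (P? : Decidable P) {n} (t : Fin n → B) →
    h (length (filter P? (tabulate t))) ≈ sum (λ i → if does (P? (t i)) then u else ε)
  length-filter-tabulate h u h0 hs P? {zero}  t = h0
  length-filter-tabulate h u h0 hs P? {suc n} t with does (P? (t zero))
  ... | true  = trans (hs _) (∙-congˡ (length-filter-tabulate h u h0 hs P? (t ∘ suc)))
  ... | false = trans (length-filter-tabulate h u h0 hs P? (t ∘ suc)) (sym (identityˡ _))

module _ {a p} {A : Set a} {P : Set p} where

  if-yes : (P? : Dec P) {x y : A} → P → (if does P? then x else y) ≡ x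
  if-yes P? {x} {y} p = ≡.cong (if_then x else y) (dec-true P? p)

  if-no : (P? : Dec P) {x y : A} → ¬ P → (if does P? then x else y) ≡ y
  if-no P? {x} {y} ¬p = ≡.cong (if_then x else y) (dec-false P? ¬p)

[-1]^-homo-+ : ∀ p q → [-1]^ (p ℙ.+ q) ≡ [-1]^ p ℤ.* [-1]^ q
[-1]^-homo-+ 0ℙ 0ℙ = ≡.refl
[-1]^-homo-+ 0ℙ 1ℙ = ≡.refl
[-1]^-homo-+ 1ℙ 0ℙ = ≡.refl
[-1]^-homo-+ 1ℙ 1ℙ = ≡.refl

sum-const-ℤ : ∀ k z → SemiringSum.sum ℤ.+-*-semiring {k} (const z) ≡ + k ℤ.* z
sum-const-ℤ zero    z = ≡.refl
sum-const-ℤ (suc k) z = ≡.trans (≡.cong (λ s → z ℤ.+ s) (sum-const-ℤ k z)) (≡.sym (ℤ.suc-* (+ k) z))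

i≡i*-1⇒i≡0 : ∀ i → i ≡ i ℤ.* ℤ.-1ℤ → i ≡ ℤ.0ℤ
i≡i*-1⇒i≡0 (+ zero)  _ = ≡.refl
i≡i*-1⇒i≡0 (+ suc _) ()
i≡i*-1⇒i≡0 -[1+ _ ]  ()

-- Fields with 2ⁿ elements: permutations, characteristic, Fermat's theorem.

module BinaryFieldProperties {c ℓ n} (K : BinaryField c ℓ n) where

  open BinaryField K hiding (zero)
  open SetoidReasoning setoid
  open SemiringSum semiring
    using (sum; sum-cong-≋; sum-replicate; ∑-distrib-+; sum-init-last; *-distribˡ-sum)
  open SemiringMult semiring using (×1-homo-*; ×-homo-1) renaming (_×_ to _×ᴷ_)
  open CommutativeExp commutativeSemiring using (^-assocʳ; ^-congˡ; ^-congʳ)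
  open GroupProperties +-group using (//-rightDividesˡ; //-rightDividesʳ; identityʳ-unique; ∙-cancelˡ)
  open RingProperties ring using (x+x≈x⇒x≈0)

  private
    module Prod = MonoidSum *-commutativeMonoid
    module ℤSum = SemiringSum ℤ.+-*-semiring
    module enum = Inverse enumeration

  index : Carrier → Fin (2 ℕ.^ n)
  index = enum.from

  element-index : ∀ x → element (index x) ≈ x
  element-index = enum.strictlyInverseˡ

  index-element : ∀ i → index (element i) ≡ i
  index-element = enum.strictlyInverseʳ

  element-injective : ∀ {i j} → element i ≈ element j → i ≡ j
  element-injective {i} {j} e =
    ≡.trans (≡.sym (index-element i)) (≡.trans (enum.from-cong e) (index-element j))

  n≢0 : n ≢ 0
  n≢0 ≡.refl = 0≉1 (trans (sym (element-index 0#))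
    (trans (reflexive (≡.cong element (Fin1-irrelevant _ _))) (element-index 1#)))
    where
    Fin1-irrelevant : (i j : Fin 1) → i ≡ j
    Fin1-irrelevant zero zero = ≡.refl

  module _ {a r} (M : CommutativeMonoid a r) where

    private
      module M = CommutativeMonoid M

    -- Conjugating `σ` by the enumeration gives a permutation of the indices. `f` must respect ≈
    -- because `element (index x)` is only equivalent to `x`.
    sum-reindex : (f : Carrier → M.Carrier) → (∀ {x y} → x ≈ y → f x M.≈ f y) →
                  (σ : Inverse setoid setoid) →
                  MonoidSum.sum M (f ∘ element) M.≈ MonoidSum.sum M (f ∘ Inverse.to σ ∘ element)
    sum-reindex f f-cong σ = M.trans
      (MonoidSum.sum-permute M (f ∘ element)
        (Composition.inverse (Composition.inverse enumeration σ) (Symmetry.inverse enumeration)))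
      (MonoidSum.sum-cong-≋ M λ i → f-cong (element-index (Inverse.to σ (element i))))

  translation : Carrier → Inverse setoid setoid
  translation y = record
    { to        = _+ y
    ; from      = _- y
    ; to-cong   = +-congʳ
    ; from-cong = +-congʳ
    ; inverse   = (λ e → trans (+-congʳ e) (//-rightDividesˡ y _))
                , (λ e → trans (+-congʳ e) (//-rightDividesʳ y _))
    }

  cancel-inverse : ∀ {x y} → x * y ≈ 1# → ∀ z → x * (y * z) ≈ z
  cancel-inverse xy≈1 z = trans (sym (*-assoc _ _ _)) (trans (*-congʳ xy≈1) (*-identityˡ z))

  scaling : ∀ {x y} → x * y ≈ 1# → Inverse setoid setoid
  scaling {x} {y} xy≈1 = record
    { to        = x *_
    ; from      = y *_
    ; to-cong   = *-congˡ
    ; from-cong = *-congˡ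
    ; inverse   = (λ e → trans (*-congˡ e) (cancel-inverse xy≈1 _))
                , (λ e → trans (*-congˡ e) (cancel-inverse (trans (*-comm y x) xy≈1) _))
    }

  *-cancelˡ : ∀ {x y z} → ¬ x ≈ 0# → x * y ≈ x * z → y ≈ z
  *-cancelˡ {x} {y} {z} x≉0 xy≈xz with x⁻¹ , xx⁻¹≈1 ← invertible x x≉0 = begin
    y              ≈⟨ cancel-inverse (trans (*-comm x⁻¹ x) xx⁻¹≈1) y ⟨
    x⁻¹ * (x * y)  ≈⟨ *-congˡ xy≈xz ⟩
    x⁻¹ * (x * z)  ≈⟨ cancel-inverse (trans (*-comm x⁻¹ x) xx⁻¹≈1) z ⟩
    z              ∎

  x*y≉0 : ∀ {x y} → ¬ x ≈ 0# → ¬ y ≈ 0# → ¬ x * y ≈ 0#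
  x*y≉0 {x} x≉0 y≉0 xy≈0 = y≉0 (*-cancelˡ x≉0 (trans xy≈0 (sym (zeroʳ x))))

  x*y≈y⇒x≈1 : ∀ {x y} → ¬ y ≈ 0# → x * y ≈ y → x ≈ 1#
  x*y≈y⇒x≈1 {x} {y} y≉0 xy≈y =
    *-cancelˡ y≉0 (trans (*-comm y x) (trans xy≈y (sym (*-identityʳ y))))

  -- Translating by 1 permutes the field, so 2ⁿ · 1 = 0, and 2ⁿ · 1 = (2 · 1)ⁿ.
  1+1≈0 : 1# + 1# ≈ 0#
  1+1≈0 with (1# + 1#) ≟ 0#
  ... | yes e = e
  ... | no ¬e = contradiction
    (identityʳ-unique (sum element) ((2 ℕ.^ n) ×ᴷ 1#) (begin
      sum element + (2 ℕ.^ n) ×ᴷ 1#                   ≈⟨ +-congˡ (sum-replicate (2 ℕ.^ n)) ⟨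
      sum element + sum {2 ℕ.^ n} (const 1#)        ≈⟨ ∑-distrib-+ element (const 1#) ⟨
      sum (λ i → element i + 1#)                    ≈⟨ sum-reindex +-commutativeMonoid id id (translation 1#) ⟨
      sum element                                   ∎))
    (2^k×1≉0 n)
    where
    2×1≉0 : ¬ 2 ×ᴷ 1# ≈ 0#
    2×1≉0 e = ¬e (trans (+-congˡ (sym (+-identityʳ 1#))) e)

    2^k×1≉0 : ∀ k → ¬ (2 ℕ.^ k) ×ᴷ 1# ≈ 0#
    2^k×1≉0 zero    e = 0≉1 (sym (trans (sym (×-homo-1 1#)) e))
    2^k×1≉0 (suc k) e = x*y≉0 2×1≉0 (2^k×1≉0 k) (trans (sym (×1-homo-* 2 (2 ℕ.^ k))) e)

  x+x≈0 : ∀ x → x + x ≈ 0#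
  x+x≈0 x = begin
    x + x            ≈⟨ +-cong (*-identityˡ x) (*-identityˡ x) ⟨
    1# * x + 1# * x  ≈⟨ distribʳ x 1# 1# ⟨
    (1# + 1#) * x    ≈⟨ *-congʳ 1+1≈0 ⟩
    0# * x           ≈⟨ zeroˡ x ⟩
    0#               ∎

  x+y≈0⇒x≈y : ∀ {x y} → x + y ≈ 0# → x ≈ y
  x+y≈0⇒x≈y {x} {y} e = ∙-cancelˡ y x y (trans (+-comm y x) (trans e (sym (x+x≈0 y))))

  ifZero : Carrier → Carrier → Carrier → Carrier
  ifZero b x y = if does (b ≟ 0#) then x else y

  ifZero-yes : ∀ {b} x y → b ≈ 0# → ifZero b x y ≈ x
  ifZero-yes x y b≈0 = reflexive (if-yes (_ ≟ 0#) b≈0)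

  ifZero-no : ∀ {b} x y → ¬ b ≈ 0# → ifZero b x y ≈ y
  ifZero-no x y b≉0 = reflexive (if-no (_ ≟ 0#) b≉0)

  product≉0 : ∀ {k} (t : Fin k → Carrier) → (∀ i → ¬ t i ≈ 0#) → ¬ Prod.sum t ≈ 0#
  product≉0 {zero}  t t≉0 e = 0≉1 (sym e)
  product≉0 {suc k} t t≉0 = x*y≉0 (t≉0 zero) (product≉0 (t ∘ suc) (t≉0 ∘ suc))

  0^ : ∀ k .{{_ : ℕ.NonZero k}} → 0# ^ k ≈ 0#
  0^ (suc k) = zeroˡ _

  -- Multiplication by x permutes the nonzero elements, so x^(2ⁿ-1) = 1.  All
  -- products run over the whole field, with a factor 1 in place of b = 0.
  x^2ⁿ≈x : ∀ x → x ^ (2 ℕ.^ n) ≈ x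
  x^2ⁿ≈x x with x ≟ 0#
  ... | yes x≈0 = begin
    x ^ (2 ℕ.^ n)   ≈⟨ ^-congˡ (2 ℕ.^ n) x≈0 ⟩
    0# ^ (2 ℕ.^ n)  ≈⟨ 0^ (2 ℕ.^ n) {{ℕ.m^n≢0 2 n}} ⟩
    0#              ≈⟨ x≈0 ⟨
    x               ∎
  ... | no x≉0 = begin
    x ^ (2 ℕ.^ n)                                    ≈⟨ Prod.sum-replicate (2 ℕ.^ n) ⟨
    ∏ (λ _ → x)                                      ≈⟨ Prod.sum-cong-≋ (λ i → split (element i)) ⟩
    ∏ (λ b → ifZero b 1# x * ifZero b x 1#)          ≈⟨ Prod.∑-distrib-+ (λ i → ifZero (element i) 1# x) _ ⟩
    ∏ (λ b → ifZero b 1# x) * ∏ (λ b → ifZero b x 1#) ≈⟨ *-cong ∏x≈1 atZero ⟩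
    1# * x                                           ≈⟨ *-identityˡ x ⟩
    x                                                ∎
    where
    ∏ : (Carrier → Carrier) → Carrier
    ∏ f = Prod.sum (f ∘ element)

    -- The 2ⁿ factors x are divided into those at b ≠ 0, which multiply to x^(2ⁿ-1), and the one at
    -- b = 0, which is the x that remains.
    split : ∀ b → x ≈ ifZero b 1# x * ifZero b x 1#
    split b with b ≟ 0#
    ... | yes b≈0 = sym (trans (*-cong (ifZero-yes 1# x b≈0) (ifZero-yes x 1# b≈0)) (*-identityˡ x))
    ... | no  b≉0 = sym (trans (*-cong (ifZero-no 1# x b≉0) (ifZero-no x 1# b≉0)) (*-identityʳ x))

    atZero : ∏ (λ b → ifZero b x 1#) ≈ x
    atZero = trans
      (sum-single *-commutativeMonoid (index 0#) _ λ j j≢ → ifZero-no x 1# λ e →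
        j≢ (element-injective (trans e (sym (element-index 0#)))))
      (ifZero-yes x 1# (element-index 0#))

    nonzeroPart : Carrier → Carrier
    nonzeroPart b = ifZero b 1# b

    nonzeroPart-cong : ∀ {b c} → b ≈ c → nonzeroPart b ≈ nonzeroPart c
    nonzeroPart-cong {b} {c} b≈c with b ≟ 0#
    ... | yes b≈0 = trans (ifZero-yes 1# b b≈0) (sym (ifZero-yes 1# c (trans (sym b≈c) b≈0)))
    ... | no  b≉0 = trans (ifZero-no 1# b b≉0)
                      (trans b≈c (sym (ifZero-no 1# c λ c≈0 → b≉0 (trans b≈c c≈0))))

    nonzeroPart≉0 : ∀ b → ¬ nonzeroPart b ≈ 0#
    nonzeroPart≉0 b with b ≟ 0#
    ... | yes b≈0 = λ e → 0≉1 (trans (sym e) (ifZero-yes 1# b b≈0))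
    ... | no  b≉0 = λ e → b≉0 (trans (sym (ifZero-no 1# b b≉0)) e)

    nonzeroPart-* : ∀ b → nonzeroPart (x * b) ≈ ifZero b 1# x * nonzeroPart b
    nonzeroPart-* b with b ≟ 0#
    ... | yes b≈0 = trans (ifZero-yes 1# (x * b) (trans (*-congˡ b≈0) (zeroʳ x)))
                      (sym (trans (*-cong (ifZero-yes 1# x b≈0) (ifZero-yes 1# b b≈0)) (*-identityˡ 1#)))
    ... | no  b≉0 = trans (ifZero-no 1# (x * b) (x*y≉0 x≉0 b≉0))
                      (sym (*-cong (ifZero-no 1# x b≉0) (ifZero-no 1# b b≉0)))

    ∏x≈1 : ∏ (λ b → ifZero b 1# x) ≈ 1#
    ∏x≈1 = x*y≈y⇒x≈1 (product≉0 _ (nonzeroPart≉0 ∘ element)) (begin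
      ∏ (λ b → ifZero b 1# x) * ∏ nonzeroPart        ≈⟨ Prod.∑-distrib-+ (λ i → ifZero (element i) 1# x) _ ⟨
      ∏ (λ b → ifZero b 1# x * nonzeroPart b)        ≈⟨ Prod.sum-cong-≋ (λ i → nonzeroPart-* (element i)) ⟨
      ∏ (λ b → nonzeroPart (x * b))                  ≈⟨ sum-reindex *-commutativeMonoid nonzeroPart nonzeroPart-cong
                                                          (scaling (proj₂ (invertible x x≉0))) ⟨
      ∏ nonzeroPart                                  ∎)

  -- Frobenius, the trace and its values in 𝔽₂.

  ^2 : ∀ x → x ^ 2 ≈ x * x
  ^2 x = *-congˡ (*-identityʳ x)

  ^2-homo-+ : ∀ x y → (x + y) ^ 2 ≈ x ^ 2 + y ^ 2
  ^2-homo-+ x y = begin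
    (x + y) ^ 2                        ≈⟨ ^2 (x + y) ⟩
    (x + y) * (x + y)                  ≈⟨ distribʳ (x + y) x y ⟩
    x * (x + y) + y * (x + y)          ≈⟨ +-cong (sym (distribˡ x x y))
                                            (trans (+-congʳ (*-comm x y)) (sym (distribˡ y x y))) ⟨
    (x * x + x * y) + (x * y + y * y)  ≈⟨ +-assoc _ _ _ ⟩
    x * x + (x * y + (x * y + y * y))  ≈⟨ +-congˡ (+-assoc _ _ _) ⟨
    x * x + ((x * y + x * y) + y * y)  ≈⟨ +-congˡ (trans (+-congʳ (x+x≈0 _)) (+-identityˡ _)) ⟩
    x * x + y * y                      ≈⟨ +-cong (^2 x) (^2 y) ⟨
    x ^ 2 + y ^ 2                      ∎

  ^2-homo-sum : ∀ {k} (t : Fin k → Carrier) → sum t ^ 2 ≈ sum (λ i → t i ^ 2)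
  ^2-homo-sum {zero}  t = zeroˡ _
  ^2-homo-sum {suc k} t = trans (^2-homo-+ _ _) (+-congˡ (^2-homo-sum (t ∘ suc)))

  frobenius-homo-+ : ∀ k x y → (x + y) ^ (2 ℕ.^ k) ≈ x ^ (2 ℕ.^ k) + y ^ (2 ℕ.^ k)
  frobenius-homo-+ zero x y = trans (*-identityʳ _) (sym (+-cong (*-identityʳ x) (*-identityʳ y)))
  frobenius-homo-+ (suc k) x y = begin
    (x + y) ^ (2 ℕ.^ suc k)                      ≈⟨ ^-assocʳ (x + y) 2 (2 ℕ.^ k) ⟨
    ((x + y) ^ 2) ^ (2 ℕ.^ k)                    ≈⟨ ^-congˡ (2 ℕ.^ k) (^2-homo-+ x y) ⟩
    (x ^ 2 + y ^ 2) ^ (2 ℕ.^ k)                  ≈⟨ frobenius-homo-+ k (x ^ 2) (y ^ 2) ⟩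
    (x ^ 2) ^ (2 ℕ.^ k) + (y ^ 2) ^ (2 ℕ.^ k)    ≈⟨ +-cong (^-assocʳ x 2 (2 ℕ.^ k)) (^-assocʳ y 2 (2 ℕ.^ k)) ⟩
    x ^ (2 ℕ.^ suc k) + y ^ (2 ℕ.^ suc k)        ∎

  trace-homo-+ : ∀ x y → trace (x + y) ≈ trace x + trace y
  trace-homo-+ x y = trans (sum-cong-≋ {n} λ i → frobenius-homo-+ (toℕ i) x y)
                           (∑-distrib-+ {n} (λ i → x ^ (2 ℕ.^ toℕ i)) _)

  trace-cong : ∀ {x y} → x ≈ y → trace x ≈ trace y
  trace-cong x≈y = sum-cong-≋ {n} λ i → ^-congˡ (2 ℕ.^ toℕ i) x≈y

  sum-shift : ∀ k (g : ℕ → Carrier) →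
              g 0 + sum {k} (λ i → g (suc (toℕ i))) ≈ sum {k} (λ i → g (toℕ i)) + g k
  sum-shift k g = trans (sum-init-last {k} (g ∘ toℕ))
    (+-cong (sum-cong-≋ {k} λ i → reflexive (≡.cong g (Fin.toℕ-inject₁ i)))
            (reflexive (≡.cong g (Fin.toℕ-fromℕ k))))

  -- Squaring shifts the conjugates x^(2^i) by one place, so it trades x for x^(2ⁿ), which is x
  -- again. An x is added on both sides so that the shift is two ways of splitting one sum.
  trace^2≈trace : ∀ x → trace x ^ 2 ≈ trace x
  trace^2≈trace x = ∙-cancelˡ x _ _ (begin
    x + trace x ^ 2                                      ≈⟨ +-cong (sym (*-identityʳ x)) (^2-homo-sum {n} _) ⟩
    x ^ 1 + sum {n} (λ i → (x ^ (2 ℕ.^ toℕ i)) ^ 2)      ≈⟨ +-congˡ (sum-cong-≋ {n} λ i → squared (toℕ i)) ⟩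
    x ^ 1 + sum {n} (λ i → x ^ (2 ℕ.^ suc (toℕ i)))      ≈⟨ sum-shift n (λ k → x ^ (2 ℕ.^ k)) ⟩
    trace x + x ^ (2 ℕ.^ n)                              ≈⟨ +-congˡ (x^2ⁿ≈x x) ⟩
    trace x + x                                          ≈⟨ +-comm _ _ ⟩
    x + trace x                                          ∎)
    where
    squared : ∀ k → (x ^ (2 ℕ.^ k)) ^ 2 ≈ x ^ (2 ℕ.^ suc k)
    squared k = trans (^-assocʳ x (2 ℕ.^ k) 2) (^-congʳ x (ℕ.*-comm (2 ℕ.^ k) 2))

  -- `Tr` is defined by a decision, which hides its algebra. Embedding 𝔽₂ in the field lets
  -- identities be checked on `trace` and pulled back by injectivity.
  fromParity : Parity → Carrier
  fromParity 0ℙ = 0#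
  fromParity 1ℙ = 1#

  fromParity-injective : ∀ {p q} → fromParity p ≈ fromParity q → p ≡ q
  fromParity-injective {0ℙ} {0ℙ} _ = ≡.refl
  fromParity-injective {0ℙ} {1ℙ} e = contradiction e 0≉1
  fromParity-injective {1ℙ} {0ℙ} e = contradiction (sym e) 0≉1
  fromParity-injective {1ℙ} {1ℙ} _ = ≡.refl

  fromParity-homo-+ : ∀ p q → fromParity (p ℙ.+ q) ≈ fromParity p + fromParity q
  fromParity-homo-+ 0ℙ q  = sym (+-identityˡ _)
  fromParity-homo-+ 1ℙ 0ℙ = sym (+-identityʳ _)
  fromParity-homo-+ 1ℙ 1ℙ = sym 1+1≈0

  -- The trace t satisfies t² = t, so a nonzero t cancels to 1.
  fromParity-Tr : ∀ x → fromParity (Tr x) ≈ trace x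
  fromParity-Tr x with trace x ≟ 0#
  ... | yes e = sym e
  ... | no ¬e = sym (x*y≈y⇒x≈1 ¬e (trans (sym (^2 _)) (trace^2≈trace x)))

  Tr-cong : ∀ {x y} → x ≈ y → Tr x ≡ Tr y
  Tr-cong {x} {y} x≈y = fromParity-injective
    (trans (fromParity-Tr x) (trans (trace-cong x≈y) (sym (fromParity-Tr y))))

  Tr-homo-+ : ∀ x y → Tr (x + y) ≡ Tr x ℙ.+ Tr y
  Tr-homo-+ x y = fromParity-injective (begin
    fromParity (Tr (x + y))                  ≈⟨ fromParity-Tr (x + y) ⟩
    trace (x + y)                            ≈⟨ trace-homo-+ x y ⟩
    trace x + trace y                        ≈⟨ +-cong (fromParity-Tr x) (fromParity-Tr y) ⟨
    fromParity (Tr x) + fromParity (Tr y)    ≈⟨ fromParity-homo-+ (Tr x) (Tr y) ⟨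
    fromParity (Tr x ℙ.+ Tr y)               ∎)

  Tr-0 : Tr 0# ≡ 0ℙ
  Tr-0 = fromParity-injective
    (trans (fromParity-Tr 0#) (x+x≈x⇒x≈0 _ (trans (sym (trace-homo-+ 0# 0#)) (trace-cong (+-identityˡ 0#)))))

  Tr-sum : ∀ {k} (t : Fin k → Carrier) →
           Tr (sum t) ≡ MonoidSum.sum ℙ.+-0-commutativeMonoid (Tr ∘ t)
  Tr-sum {zero}  t = Tr-0
  Tr-sum {suc k} t = ≡.trans (Tr-homo-+ _ _) (≡.cong (Tr (t zero) ℙ.+_) (Tr-sum (t ∘ suc)))

  -- The additive character and its orthogonality; the sum of all elements.

  χ : Carrier → ℤ
  χ x = [-1]^ (Tr x)

  χ-cong : ∀ {x y} → x ≈ y → χ x ≡ χ y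
  χ-cong x≈y = ≡.cong [-1]^_ (Tr-cong x≈y)

  χ-homo-+ : ∀ x y → χ (x + y) ≡ χ x ℤ.* χ y
  χ-homo-+ x y = ≡.trans (≡.cong [-1]^_ (Tr-homo-+ x y)) ([-1]^-homo-+ (Tr x) (Tr y))

  -- Translation by y with Tr y = 1 permutes the summands and flips every sign, so the sum is its
  -- own negative.
  sum-χ≡0 : (∃ λ y → Tr y ≡ 1ℙ) → ℤSum.sum (χ ∘ element) ≡ ℤ.0ℤ
  sum-χ≡0 (y , Try≡1) = i≡i*-1⇒i≡0 _ (≡.trans
    (sum-reindex ℤ.+-0-commutativeMonoid χ χ-cong (translation y)) (≡.trans
    (ℤSum.sum-cong-≗ λ i →
      ≡.trans (χ-homo-+ (element i) y) (≡.cong (λ p → χ (element i) ℤ.* [-1]^ p) Try≡1))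
    (≡.sym (ℤSum.*-distribʳ-sum ℤ.-1ℤ (χ ∘ element)))))

  -- For c ≠ 0, scaling by c permutes the field and reduces the sum to that of χ itself; for c = 0
  -- every summand is 1.
  χ-orthogonality : (∃ λ y → Tr y ≡ 1ℙ) → ∀ c →
    ℤSum.sum (λ i → χ (element i * c)) ≡ (if does (c ≟ 0#) then + (2 ℕ.^ n) else ℤ.0ℤ)
  χ-orthogonality nontrivial c with c ≟ 0#
  ... | yes c≈0 = ≡.trans
    (ℤSum.sum-cong-≗ {2 ℕ.^ n} λ i →
      ≡.trans (χ-cong (trans (*-congˡ c≈0) (zeroʳ (element i)))) (≡.cong [-1]^_ Tr-0))
    (≡.trans (sum-const-ℤ (2 ℕ.^ n) ℤ.1ℤ) (≡.trans (ℤ.*-identityʳ _) (≡.sym (if-yes (c ≟ 0#) c≈0))))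
  ... | no c≉0 = ≡.trans
    (ℤSum.sum-cong-≗ λ i → χ-cong (*-comm (element i) c)) (≡.trans
    (≡.sym (sum-reindex ℤ.+-0-commutativeMonoid χ χ-cong (scaling (proj₂ (invertible c c≉0)))))
    (≡.trans (sum-χ≡0 nontrivial) (≡.sym (if-no (c ≟ 0#) c≉0))))

  sum-atZero : ∀ z → ℤSum.sum (λ i → if does (element i ≟ 0#) then z else ℤ.0ℤ) ≡ z
  sum-atZero z = ≡.trans
    (sum-single ℤ.+-0-commutativeMonoid (index 0#) _ λ j j≢ → if-no (element j ≟ 0#) λ e →
      j≢ (element-injective (trans e (sym (element-index 0#)))))
    (if-yes (element (index 0#) ≟ 0#) (element-index 0#))

  -- A multiplier x ∉ {0, 1} fixes the sum S of all elements, so S = 0.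
  sum-element≈0 : 2 ≤ n → sum element ≈ 0#
  sum-element≈0 2≤n with sum element ≟ 0#
  ... | yes e = e
  -- If S ≠ 0, cancelling it from xS = S makes every nonzero x equal to 1. Testing for zero then
  -- embeds the field in a two-element set, against 2 < 2ⁿ.
  ... | no S≉0 = contradiction
    (Fin.injective⇒≤ {f = λ i → isZero (element i)} isZero-injective)
    (ℕ.<⇒≱ (ℕ.^-monoʳ-< 2 ℕ.≤-refl 2≤n))
    where
    x≈1 : ∀ x → ¬ x ≈ 0# → x ≈ 1#
    x≈1 x x≉0 = x*y≈y⇒x≈1 S≉0 (begin
      x * sum element             ≈⟨ *-distribˡ-sum x element ⟩
      sum (λ i → x * element i)   ≈⟨ sum-reindex +-commutativeMonoid id id
                                       (scaling (proj₂ (invertible x x≉0))) ⟨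
      sum element                 ∎)

    isZero : Carrier → Fin 2
    isZero x = if does (x ≟ 0#) then zero else suc zero

    isZero-injective : ∀ {i j} → isZero (element i) ≡ isZero (element j) → i ≡ j
    isZero-injective {i} {j} e with element i ≟ 0# | element j ≟ 0#
    ... | yes p | yes q = element-injective (trans p (sym q))
    ... | no  p | no  q = element-injective (trans (x≈1 _ p) (sym (x≈1 _ q)))
    ... | yes p | no  q = contradiction
      (≡.trans (≡.sym (if-yes (element i ≟ 0#) p)) (≡.trans e (if-no (element j ≟ 0#) q))) λ ()
    ... | no  p | yes q = contradiction
      (≡.trans (≡.sym (if-no (element i ≟ 0#) p)) (≡.trans e (if-yes (element j ≟ 0#) q))) λ ()

-- Squares that are powers of two, and signs.

4*q^2≡[q*2]^2 : ∀ q → 4 ℕ.* q ℕ.^ 2 ≡ (q ℕ.* 2) ℕ.^ 2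
4*q^2≡[q*2]^2 = solve 1 (λ q → con 4 :* q :^ 2 := (q :* con 2) :^ 2) ≡.refl
  where open ℕ-Solver.+-*-Solver

-- Descent in steps of two: by Euclid's lemma w is even, and halving it turns 2^(n+2) into 2ⁿ. Odd n
-- end at w² = 2, which lies strictly between 1² and 2².
square≡2^n : ∀ n w → w ℕ.^ 2 ≡ 2 ℕ.^ n → ∃ λ h → n ≡ 2 ℕ.* h × w ≡ 2 ℕ.^ h
square≡2^n 0 w e = 0 , ≡.refl , [ (λ ()) , id ]′ (ℕ.m^n≡1⇒n≡0∨m≡1 w 2 e)
square≡2^n 1 0 ()
square≡2^n 1 1 ()
square≡2^n 1 (suc (suc w)) e =
  contradiction (ℕ.^-monoˡ-≤ 2 {2} {suc (suc w)} (ℕ.s≤s (ℕ.s≤s ℕ.z≤n)))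
                (ℕ.<⇒≱ (≡.subst (ℕ._< 4) (≡.sym e) (ℕ.s≤s (ℕ.s≤s (ℕ.s≤s ℕ.z≤n)))))
square≡2^n (suc (suc n)) w e
  with divides q w≡q*2 ← [ id , id ]′ (euclidsLemma w w prime[2]
         (divides (2 ℕ.^ suc n)
           (≡.trans (≡.cong (w ℕ.*_) (≡.sym (ℕ.*-identityʳ w))) (≡.trans e (ℕ.*-comm 2 (2 ℕ.^ suc n))))))
  with h , n≡2h , q≡2^h ← square≡2^n n q (ℕ.*-cancelˡ-≡ (q ℕ.^ 2) (2 ℕ.^ n) 4
         (≡.trans (4*q^2≡[q*2]^2 q) (≡.trans (≡.cong (ℕ._^ 2) (≡.sym w≡q*2))
           (≡.trans e (≡.sym (ℕ.*-assoc 2 2 (2 ℕ.^ n)))))))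
  = suc h , ≡.trans (≡.cong (2 ℕ.+_) n≡2h) (≡.sym (ℕ.*-suc 2 h))
          , ≡.trans w≡q*2 (≡.trans (ℕ.*-comm q 2) (≡.cong (2 ℕ.*_) q≡2^h))

[-1]^-injective : ∀ {p q} → [-1]^ p ≡ [-1]^ q → p ≡ q
[-1]^-injective {0ℙ} {0ℙ} _ = ≡.refl
[-1]^-injective {1ℙ} {1ℙ} _ = ≡.refl

signed : ∀ z → ∃ λ s → z ≡ + ∣ z ∣ ℤ.* [-1]^ s
signed (+ k)    = 0ℙ , ≡.sym (ℤ.*-identityʳ (+ k))
signed -[1+ k ] = 1ℙ , ≡.sym (≡.trans (ℤ.*-comm (+ suc k) ℤ.-1ℤ) (ℤ.-1*i≡-i (+ suc k)))

-- Powers of two with integer exponents in ℚ.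

-- Reduction by a gcd blocks computation in ℚ. The identities below are therefore checked on
-- unnormalised fractions, where equality is an integer identity after cross-multiplication.
toℚᵘ-/ : ∀ z d → toℚᵘ (z ℚ./ suc d) ℚᵘ.≃ mkℚᵘ z d
toℚᵘ-/ z d = ℚ.toℚᵘ-fromℚᵘ (mkℚᵘ z d)

fromℕ-homo-+ : ∀ i j → fromℕ (i ℕ.+ j) ≡ fromℕ i ℚ.+ fromℕ j
fromℕ-homo-+ i j = ℚ.toℚᵘ-injective (begin
  toℚᵘ (fromℕ (i ℕ.+ j))               ≈⟨ toℚᵘ-/ (+ (i ℕ.+ j)) 0 ⟩
  mkℚᵘ (+ (i ℕ.+ j)) 0                 ≈⟨ *≡* (≡.cong (ℤ._* + 1)
                                            (≡.sym (≡.cong₂ ℤ._+_ (ℤ.*-identityʳ (+ i)) (ℤ.*-identityʳ (+ j))))) ⟩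
  mkℚᵘ (+ i) 0 ℚᵘ.+ mkℚᵘ (+ j) 0       ≈⟨ ℚᵘ.+-cong (toℚᵘ-/ (+ i) 0) (toℚᵘ-/ (+ j) 0) ⟨
  toℚᵘ (fromℕ i) ℚᵘ.+ toℚᵘ (fromℕ j)   ≈⟨ ℚ.toℚᵘ-homo-+ (fromℕ i) (fromℕ j) ⟨
  toℚᵘ (fromℕ i ℚ.+ fromℕ j)           ∎)
  where open ℚᵘ.≃-Reasoning

fromℕ-homo-* : ∀ i j → fromℕ (i ℕ.* j) ≡ fromℕ i ℚ.* fromℕ j
fromℕ-homo-* i j = ℚ.toℚᵘ-injective (begin
  toℚᵘ (fromℕ (i ℕ.* j))               ≈⟨ toℚᵘ-/ (+ (i ℕ.* j)) 0 ⟩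
  mkℚᵘ (+ (i ℕ.* j)) 0                 ≈⟨ *≡* (≡.cong (ℤ._* + 1) (ℤ.pos-* i j)) ⟩
  mkℚᵘ (+ i) 0 ℚᵘ.* mkℚᵘ (+ j) 0       ≈⟨ ℚᵘ.*-cong (toℚᵘ-/ (+ i) 0) (toℚᵘ-/ (+ j) 0) ⟨
  toℚᵘ (fromℕ i) ℚᵘ.* toℚᵘ (fromℕ j)   ≈⟨ ℚ.toℚᵘ-homo-* (fromℕ i) (fromℕ j) ⟨
  toℚᵘ (fromℕ i ℚ.* fromℕ j)           ∎)
  where open ℚᵘ.≃-Reasoning

1/d*d≡1 : ∀ d .{{_ : ℕ.NonZero d}} → (+ 1 ℚ./ d) ℚ.* fromℕ d ≡ 1ℚ
1/d*d≡1 d@(suc d-1) = ℚ.toℚᵘ-injective (begin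
  toℚᵘ ((+ 1 ℚ./ d) ℚ.* fromℕ d)           ≈⟨ ℚ.toℚᵘ-homo-* (+ 1 ℚ./ d) (fromℕ d) ⟩
  toℚᵘ (+ 1 ℚ./ d) ℚᵘ.* toℚᵘ (fromℕ d)     ≈⟨ ℚᵘ.*-cong (toℚᵘ-/ (+ 1) d-1) (toℚᵘ-/ (+ d) 0) ⟩
  mkℚᵘ (+ 1) d-1 ℚᵘ.* mkℚᵘ (+ d) 0         ≈⟨ *≡* (≡.trans (ℤ.*-identityʳ (+ 1 ℤ.* + d))
                                                  (≡.cong (λ e → + 1 ℤ.* + e) (≡.sym (ℕ.*-identityʳ d)))) ⟩
  toℚᵘ 1ℚ                                  ∎)
  where open ℚᵘ.≃-Reasoning

-- With the denominator cleared, both exponents can drop together until one of them is 0; only then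
-- does the sign of the exponent select a branch of `2^_`.
2^-⊖ : ∀ i j → 2^ (i ℤ.⊖ j) ℚ.* fromℕ (2 ℕ.^ j) ≡ fromℕ (2 ℕ.^ i)
2^-⊖ i       zero    = ℚ.*-identityʳ (fromℕ (2 ℕ.^ i))
2^-⊖ zero    (suc j) = 1/d*d≡1 (2 ℕ.^ suc j) {{ℕ.m^n≢0 2 (suc j)}}
2^-⊖ (suc i) (suc j) = begin
  2^ (suc i ℤ.⊖ suc j) ℚ.* fromℕ (2 ℕ.* 2 ℕ.^ j)
    ≡⟨ ≡.cong₂ (λ e q → 2^ e ℚ.* q) (ℤ.[1+m]⊖[1+n]≡m⊖n i j) (double (2 ℕ.^ j)) ⟩
  2^ (i ℤ.⊖ j) ℚ.* (fromℕ (2 ℕ.^ j) ℚ.* fromℕ 2)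
    ≡⟨ ℚ.*-assoc (2^ (i ℤ.⊖ j)) (fromℕ (2 ℕ.^ j)) (fromℕ 2) ⟨
  2^ (i ℤ.⊖ j) ℚ.* fromℕ (2 ℕ.^ j) ℚ.* fromℕ 2
    ≡⟨ ≡.cong (ℚ._* fromℕ 2) (2^-⊖ i j) ⟩
  fromℕ (2 ℕ.^ i) ℚ.* fromℕ 2
    ≡⟨ double (2 ℕ.^ i) ⟨
  fromℕ (2 ℕ.^ suc i) ∎
  where
  open ≡.≡-Reasoning

  double : ∀ k → fromℕ (2 ℕ.* k) ≡ fromℕ k ℚ.* fromℕ 2
  double k = ≡.trans (≡.cong fromℕ (ℕ.*-comm 2 k)) (fromℕ-homo-* k 2)

2^-‿- : ∀ i j → 2^ (+ i ℤ.- + j) ℚ.* fromℕ (2 ℕ.^ j) ≡ fromℕ (2 ℕ.^ i)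
2^-‿- i j = ≡.trans (≡.cong (λ e → 2^ e ℚ.* fromℕ (2 ℕ.^ j)) (ℤ.[+m]-[+n]≡m⊖n i j)) (2^-⊖ i j)

-- Here c stands for 2k_a + 1, and the hypothesis is the desired formula multiplied by 2^m and freed
-- of subtraction.
divide-by-2^m : ∀ n h m N c →
  N ℕ.* 2 ℕ.^ m ℕ.+ 2 ℕ.^ h ℕ.* c ≡ 2 ℕ.^ n ℕ.+ 2 ℕ.^ h ℕ.* 2 ℕ.^ m →
  fromℕ N ≡ 2^ (+ n ℤ.- + m) ℚ.+ 2^ (+ h) ℚ.- 2^ (+ h ℤ.- + m) ℚ.* fromℕ c
divide-by-2^m n h m N c e = begin
  fromℕ N
    ≡⟨ ℚ.*-identityʳ (fromℕ N) ⟨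
  fromℕ N ℚ.* 1ℚ
    ≡⟨ ≡.cong (fromℕ N ℚ.*_) QP≡1 ⟨
  fromℕ N ℚ.* (Q ℚ.* P)
    -- The term x = 2^h c is added and subtracted to expose the left side of the hypothesis.
    ≡⟨ solve 4 (λ N Q P x → N :* (Q :* P) := (N :* P :+ x) :* Q :- x :* Q)
         ≡.refl (fromℕ N) Q P (H ℚ.* fromℕ c) ⟩
  (fromℕ N ℚ.* P ℚ.+ H ℚ.* fromℕ c) ℚ.* Q ℚ.- H ℚ.* fromℕ c ℚ.* Q
    ≡⟨ ≡.cong (λ x → x ℚ.* Q ℚ.- H ℚ.* fromℕ c ℚ.* Q) e′ ⟩
  (2^ (+ n) ℚ.+ H ℚ.* P) ℚ.* Q ℚ.- H ℚ.* fromℕ c ℚ.* Q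
    ≡⟨ ≡.cong₂ (λ x y → (x ℚ.+ H ℚ.* P) ℚ.* Q ℚ.- y ℚ.* fromℕ c ℚ.* Q) (2^-‿- n m) (2^-‿- h m) ⟨
  (X ℚ.* P ℚ.+ H ℚ.* P) ℚ.* Q ℚ.- Y ℚ.* P ℚ.* fromℕ c ℚ.* Q
    ≡⟨ solve 6 (λ X P H Q Y c → (X :* P :+ H :* P) :* Q :- Y :* P :* c :* Q := (X :+ H :- Y :* c) :* (Q :* P))
         ≡.refl X P H Q Y (fromℕ c) ⟩
  (X ℚ.+ H ℚ.- Y ℚ.* fromℕ c) ℚ.* (Q ℚ.* P)
    ≡⟨ ≡.cong ((X ℚ.+ H ℚ.- Y ℚ.* fromℕ c) ℚ.*_) QP≡1 ⟩
  (X ℚ.+ H ℚ.- Y ℚ.* fromℕ c) ℚ.* 1ℚ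
    ≡⟨ ℚ.*-identityʳ _ ⟩
  X ℚ.+ H ℚ.- Y ℚ.* fromℕ c ∎
  where
  open ≡.≡-Reasoning
  open ℚ-Solver.+-*-Solver
  X = 2^ (+ n ℤ.- + m)
  Y = 2^ (+ h ℤ.- + m)
  H = 2^ (+ h)
  P = fromℕ (2 ℕ.^ m)
  Q = 2^ (+ 0 ℤ.- + m)

  QP≡1 : Q ℚ.* P ≡ 1ℚ
  QP≡1 = 2^-‿- 0 m

  e′ : fromℕ N ℚ.* P ℚ.+ H ℚ.* fromℕ c ≡ 2^ (+ n) ℚ.+ H ℚ.* P
  e′ = begin
    fromℕ N ℚ.* P ℚ.+ H ℚ.* fromℕ c
      ≡⟨ ≡.cong₂ ℚ._+_ (fromℕ-homo-* N (2 ℕ.^ m)) (fromℕ-homo-* (2 ℕ.^ h) c) ⟨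
    fromℕ (N ℕ.* 2 ℕ.^ m) ℚ.+ fromℕ (2 ℕ.^ h ℕ.* c)
      ≡⟨ fromℕ-homo-+ (N ℕ.* 2 ℕ.^ m) (2 ℕ.^ h ℕ.* c) ⟨
    fromℕ (N ℕ.* 2 ℕ.^ m ℕ.+ 2 ℕ.^ h ℕ.* c)
      ≡⟨ ≡.cong fromℕ e ⟩
    fromℕ (2 ℕ.^ n ℕ.+ 2 ℕ.^ h ℕ.* 2 ℕ.^ m)
      ≡⟨ fromℕ-homo-+ (2 ℕ.^ n) (2 ℕ.^ h ℕ.* 2 ℕ.^ m) ⟩
    2^ (+ n) ℚ.+ fromℕ (2 ℕ.^ h ℕ.* 2 ℕ.^ m)
      ≡⟨ ≡.cong (2^ (+ n) ℚ.+_) (fromℕ-homo-* (2 ℕ.^ h) (2 ℕ.^ m)) ⟩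
    2^ (+ n) ℚ.+ H ℚ.* P ∎

-- Walsh values at a = 0 and Fourier inversion.

module _ {c₁ ℓ₁ c₂ ℓ₂} {n m : ℕ} (K : BinaryField c₁ ℓ₁ n) (L : BinaryField c₂ ℓ₂ m)
         (F : Func (BinaryField.setoid K) (BinaryField.setoid L)) where

  private
    module K  = BinaryField K
    module L  = BinaryField L
    module KP = BinaryFieldProperties K
    module LP = BinaryFieldProperties L

  open Func F using (to)
  open LP using (χ)
  open SemiringSum ℤ.+-*-semiring
    using (sum; sum-cong-≗; ∑-distrib-+; ∑-comm; *-distribʳ-sum)

  W : L.Carrier → ℤ
  W b = Walsh K L F b K.0#

  W≡sum : ∀ b → W b ≡ sum (λ i → χ (b L.* to (K.element i)))
  W≡sum b = sum-cong-≗ λ i → ≡.cong [-1]^_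
    (≡.trans (≡.cong (L.Tr (b L.* to (K.element i)) ℙ.+_)
                     (≡.trans (KP.Tr-cong (K.zeroˡ (K.element i))) KP.Tr-0))
             (ℙ.+-identityʳ _))

  Tr≡0⇒W≡2ⁿ : ∀ b → (∀ i → L.Tr (b L.* to (K.element i)) ≡ 0ℙ) → W b ≡ + (2 ℕ.^ n)
  Tr≡0⇒W≡2ⁿ b Tr≡0 = ≡.trans (W≡sum b)
    (≡.trans (sum-cong-≗ λ i → ≡.cong [-1]^_ (Tr≡0 i))
             (≡.trans (sum-const-ℤ (2 ℕ.^ n) ℤ.1ℤ) (ℤ.*-identityʳ (+ (2 ℕ.^ n)))))

  W-0 : ∀ {b} → b L.≈ L.0# → W b ≡ + (2 ℕ.^ n)
  W-0 b≈0 = Tr≡0⇒W≡2ⁿ _ λ i →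
    ≡.trans (LP.Tr-cong (L.trans (L.*-congʳ b≈0) (L.zeroˡ _))) LP.Tr-0

  -- If Tr vanished on L, then W 1 = 2ⁿ would exceed the bent value 2^{n/2}.
  bent⇒Tr-nontrivial : Bent K L F → ∃ λ y → L.Tr y ≡ 1ℙ
  bent⇒Tr-nontrivial bent with Fin.any? (λ j → L.Tr (L.element j) ℙ.≟ 1ℙ)
  ... | yes (j , e) = L.element j , e
  ... | no ¬1ℙ = contradiction
    (≡.trans (≡.sym (ℕ.^-*-assoc 2 n 2))
             (≡.trans (≡.cong (λ w → ∣ w ∣ ℕ.^ 2) (≡.sym (Tr≡0⇒W≡2ⁿ L.1# λ i → Tr≡0 _)))
                      (bent L.1# (L.0≉1 ∘ L.sym) K.0#)))
    -- The other argument equates 2^(2n) with 2ⁿ, which is impossible since n ≠ 0.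
    (ℕ.>⇒≢ (ℕ.^-monoʳ-< 2 ℕ.≤-refl (ℕ.m<m*n n 2 {{ℕ.≢-nonZero KP.n≢0}} ℕ.≤-refl)))
    where
    p≢1⇒p≡0 : ∀ {p} → p ≢ 1ℙ → p ≡ 0ℙ
    p≢1⇒p≡0 {0ℙ} _ = ≡.refl
    p≢1⇒p≡0 {1ℙ} p≢1 = contradiction ≡.refl p≢1

    Tr≡0 : ∀ y → L.Tr y ≡ 0ℙ
    Tr≡0 y = ≡.trans (LP.Tr-cong (L.sym (LP.element-index y)))
                     (p≢1⇒p≡0 λ e → ¬1ℙ (LP.index y , e))

  -- After exchanging the sums, the inner one runs over χ(b(F(x) + a)). Orthogonality leaves 2^m
  -- exactly when F(x) + a = 0, which in characteristic 2 means F(x) = a.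
  fourier-inversion : (∃ λ y → L.Tr y ≡ 1ℙ) → ∀ a →
    sum (λ j → W (L.element j) ℤ.* χ (a L.* L.element j)) ≡ + (∣preimage∣ K L F a ℕ.* 2 ℕ.^ m)
  fourier-inversion nontrivial a = begin
    sum (λ j → W (L.element j) ℤ.* χ (a L.* L.element j))
      ≡⟨ sum-cong-≗ (λ j → expand (L.element j)) ⟩
    sum (λ j → sum λ i → χ (L.element j L.* (to (K.element i) L.+ a)))
      ≡⟨ ∑-comm (λ j i → χ (L.element j L.* (to (K.element i) L.+ a))) ⟩
    sum (λ i → sum λ j → χ (L.element j L.* (to (K.element i) L.+ a)))
      ≡⟨ sum-cong-≗ (λ i → ≡.trans (LP.χ-orthogonality nontrivial (to (K.element i) L.+ a))
                                   (indicator (to (K.element i)))) ⟩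
    sum (λ i → if does (to (K.element i) L.≟ a) then + (2 ℕ.^ m) else ℤ.0ℤ)
      ≡⟨ length-filter-tabulate ℤ.+-0-commutativeMonoid (λ k → + (k ℕ.* 2 ℕ.^ m)) (+ (2 ℕ.^ m))
           ≡.refl (λ _ → ≡.refl) (λ x → to x L.≟ a) K.element ⟨
    + (∣preimage∣ K L F a ℕ.* 2 ℕ.^ m) ∎
    where
    open ≡.≡-Reasoning

    expand : ∀ b → W b ℤ.* χ (a L.* b) ≡ sum (λ i → χ (b L.* (to (K.element i) L.+ a)))
    expand b = ≡.trans (≡.cong (ℤ._* χ (a L.* b)) (W≡sum b))
      (≡.trans (*-distribʳ-sum (χ (a L.* b)) (λ i → χ (b L.* to (K.element i))))
        (sum-cong-≗ λ i → ≡.trans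
          (≡.sym (LP.χ-homo-+ (b L.* to (K.element i)) (a L.* b)))
          (LP.χ-cong (L.trans (L.+-congˡ (L.*-comm a b)) (L.sym (L.distribˡ b (to (K.element i)) a))))))

    indicator : ∀ y → (if does ((y L.+ a) L.≟ L.0#) then + (2 ℕ.^ m) else ℤ.0ℤ)
                    ≡ (if does (y L.≟ a) then + (2 ℕ.^ m) else ℤ.0ℤ)
    indicator y with y L.≟ a
    ... | yes y≈a = ≡.trans (if-yes ((y L.+ a) L.≟ L.0#) (L.trans (L.+-congʳ y≈a) (LP.x+x≈0 a)))
                            (≡.sym (if-yes (y L.≟ a) y≈a))
    ... | no  y≉a = ≡.trans (if-no ((y L.+ a) L.≟ L.0#) (y≉a ∘ LP.x+y≈0⇒x≈y))
                            (≡.sym (if-no (y L.≟ a) y≉a))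

  -- Signs of the Walsh values and the preimage formula.

  module _ (bent : Bent K L F) {h : ℕ} (n≡2h : n ≡ 2 ℕ.* h) where

    private
      module ℙSum = MonoidSum ℙ.+-0-commutativeMonoid

      H = 2 ℕ.^ h

      instance
        H-nonZero : ℤ.NonZero (+ H)
        H-nonZero = ℕ.m^n≢0 2 h

    -- The exponent extracted from |W|² = 2ⁿ depends a priori on b; it is h because twice it is n.
    W≡±H : ∀ b → ¬ b L.≈ L.0# → ∃ λ s → W b ≡ + H ℤ.* [-1]^ s
    W≡±H b b≉0
      with h′ , n≡2h′ , ∣W∣≡2^h′ ← square≡2^n n ∣ W b ∣ (bent b b≉0 K.0#)
      with s , W≡ ← signed (W b)
      with ≡.refl ← ℕ.*-cancelˡ-≡ h h′ 2 (≡.trans (≡.sym n≡2h) n≡2h′)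
      = s , ≡.trans W≡ (≡.cong (λ k → + k ℤ.* [-1]^ s) ∣W∣≡2^h′)

    -- Definitionally the predicate filtered in `k`, so sums over `counted?` yield k_a without
    -- conversion.
    Counted : L.Carrier → L.Carrier → Set ℓ₂
    Counted a b = ¬ (b L.≈ L.0#) × W b ≡ ℤ.- (+ H) ℤ.* χ (a L.* b)

    counted? : ∀ a b → Dec (Counted a b)
    counted? a b = ¬? (b L.≟ L.0#) ×-dec (W b ℤ.≟ ℤ.- (+ H) ℤ.* χ (a L.* b))

    -H*[-1]^ : ∀ t → ℤ.- (+ H) ℤ.* [-1]^ t ≡ + H ℤ.* [-1]^ (1ℙ ℙ.+ t)
    -H*[-1]^ t = begin
      ℤ.- (+ H) ℤ.* [-1]^ t              ≡⟨ ≡.cong (ℤ._* [-1]^ t)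
                                              (≡.trans (ℤ.*-comm (+ H) ℤ.-1ℤ) (ℤ.-1*i≡-i (+ H))) ⟨
      + H ℤ.* ℤ.-1ℤ ℤ.* [-1]^ t          ≡⟨ ℤ.*-assoc (+ H) ℤ.-1ℤ ([-1]^ t) ⟩
      + H ℤ.* (ℤ.-1ℤ ℤ.* [-1]^ t)        ≡⟨ ≡.cong (+ H ℤ.*_) ([-1]^-homo-+ 1ℙ t) ⟨
      + H ℤ.* [-1]^ (1ℙ ℙ.+ t)           ∎
      where open ≡.≡-Reasoning

    module _ (a : L.Carrier) {b : L.Carrier} {s : Parity}
             (b≉0 : ¬ b L.≈ L.0#) (W≡ : W b ≡ + H ℤ.* [-1]^ s) where

      private
        t = L.Tr (a L.* b)

        1+t+t≡1 : 1ℙ ℙ.+ t ℙ.+ t ≡ 1ℙ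
        1+t+t≡1 = ≡.trans (ℙ.+-assoc 1ℙ t t) (≡.cong (1ℙ ℙ.+_) (ℙ.p+p≡0ℙ t))

      -- The summand W(b) χ(ab) is H (-1)^(s+t), so s + t = 1 singles out the negative summands;
      -- this and `¬counted` settle the two cases.
      counted : s ℙ.+ t ≡ 1ℙ → Counted a b
      counted s+t≡1 = b≉0 , (begin
        W b                        ≡⟨ W≡ ⟩
        + H ℤ.* [-1]^ s            ≡⟨ ≡.cong (λ p → + H ℤ.* [-1]^ p) s≡1+t ⟩
        + H ℤ.* [-1]^ (1ℙ ℙ.+ t)   ≡⟨ -H*[-1]^ t ⟨
        ℤ.- (+ H) ℤ.* [-1]^ t      ∎)
        where
        open ≡.≡-Reasoning
        s≡1+t : s ≡ 1ℙ ℙ.+ t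
        s≡1+t = ℙ.+-cancelʳ-≡ t s (1ℙ ℙ.+ t) (≡.trans s+t≡1 (≡.sym 1+t+t≡1))

      ¬counted : s ℙ.+ t ≡ 0ℙ → ¬ Counted a b
      ¬counted s+t≡0 (_ , W≡-Hχ) =
        contradiction (≡.trans (≡.sym s+t≡0) (≡.trans (≡.cong (ℙ._+ t) s≡1+t) 1+t+t≡1)) λ ()
        where
        s≡1+t : s ≡ 1ℙ ℙ.+ t
        s≡1+t = [-1]^-injective (ℤ.*-cancelˡ-≡ (+ H) ([-1]^ s) ([-1]^ (1ℙ ℙ.+ t))
          (≡.trans (≡.sym W≡) (≡.trans W≡-Hχ (-H*[-1]^ t))))

    -- The summand at b ≠ 0 is ±H, with − when b is counted, and at b = 0 it is 2ⁿ;
    -- the corrections are placed so that summing over b needs no subtraction.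
    Wχ-balance : ∀ a b →
      W b ℤ.* χ (a L.* b)
        ℤ.+ (if does (counted? a b) then + (H ℕ.+ H) else ℤ.0ℤ)
        ℤ.+ (if does (b L.≟ L.0#) then + H else ℤ.0ℤ)
      ≡ + H ℤ.+ (if does (b L.≟ L.0#) then + (2 ℕ.^ n) else ℤ.0ℤ)
    Wχ-balance a b with b L.≟ L.0#
    ... | yes b≈0 = begin
      _ ≡⟨ ≡.cong₂ ℤ._+_
             (≡.cong₂ ℤ._+_ (≡.cong₂ ℤ._*_ (W-0 b≈0) χ≡1) (if-no (counted? a b) λ c → proj₁ c b≈0))
             (if-yes (b L.≟ L.0#) b≈0) ⟩
      + (2 ℕ.^ n) ℤ.* ℤ.1ℤ ℤ.+ ℤ.0ℤ ℤ.+ + H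
        ≡⟨ ≡.cong (ℤ._+ + H) (≡.trans (ℤ.+-identityʳ _) (ℤ.*-identityʳ (+ (2 ℕ.^ n)))) ⟩
      + (2 ℕ.^ n) ℤ.+ + H
        ≡⟨ ℤ.+-comm (+ (2 ℕ.^ n)) (+ H) ⟩
      + H ℤ.+ + (2 ℕ.^ n)
        ≡⟨ ≡.cong (λ z → + H ℤ.+ z) (if-yes (b L.≟ L.0#) b≈0) ⟨
      _ ∎
      where
      open ≡.≡-Reasoning
      χ≡1 : χ (a L.* b) ≡ ℤ.1ℤ
      χ≡1 = ≡.cong [-1]^_ (≡.trans (LP.Tr-cong (L.trans (L.*-congˡ b≈0) (L.zeroʳ a))) LP.Tr-0)
    ... | no b≉0 with s , W≡ ← W≡±H b b≉0 = begin
      _ ≡⟨ ≡.cong₂ ℤ._+_ (≡.cong (ℤ._+ ind) Wχ≡) (if-no (b L.≟ L.0#) b≉0) ⟩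
      + H ℤ.* [-1]^ (s ℙ.+ t) ℤ.+ ind ℤ.+ ℤ.0ℤ
        ≡⟨ ≡.cong (ℤ._+ ℤ.0ℤ) (bySign (s ℙ.+ t) ≡.refl) ⟩
      + H ℤ.+ ℤ.0ℤ
        ≡⟨ ≡.cong (λ z → + H ℤ.+ z) (if-no (b L.≟ L.0#) b≉0) ⟨
      _ ∎
      where
      open ≡.≡-Reasoning
      t   = L.Tr (a L.* b)
      ind = if does (counted? a b) then + (H ℕ.+ H) else ℤ.0ℤ

      Wχ≡ : W b ℤ.* χ (a L.* b) ≡ + H ℤ.* [-1]^ (s ℙ.+ t)
      Wχ≡ = ≡.trans (≡.cong (ℤ._* [-1]^ t) W≡)
        (≡.trans (ℤ.*-assoc (+ H) ([-1]^ s) ([-1]^ t)) (≡.cong (+ H ℤ.*_) (≡.sym ([-1]^-homo-+ s t))))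

      bySign : ∀ p → s ℙ.+ t ≡ p → + H ℤ.* [-1]^ p ℤ.+ ind ≡ + H
      bySign 0ℙ e = ≡.trans
        (≡.cong₂ ℤ._+_ (ℤ.*-identityʳ (+ H)) (if-no (counted? a b) (¬counted a b≉0 W≡ e)))
        (ℤ.+-identityʳ (+ H))
      bySign 1ℙ e = ≡.trans
        (≡.cong (λ z → + H ℤ.* ℤ.-1ℤ ℤ.+ z) (if-yes (counted? a b) (counted a b≉0 W≡ e)))
        (solve 1 (λ x → x :* con ℤ.-1ℤ :+ (x :+ x) := x) ≡.refl (+ H))
        where open ℤ-Solver.+-*-Solver

    -- This is `Wχ-balance` summed over b. Each counted b contributes 2H, and the correction at b =
    -- 0 a single further H: this is the +1 in 2k_a + 1.
    preimage-count : ∀ a →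
      ∣preimage∣ K L F a ℕ.* 2 ℕ.^ m ℕ.+ H ℕ.* (2 ℕ.* k K L F h a ℕ.+ 1) ≡ 2 ℕ.^ n ℕ.+ H ℕ.* 2 ℕ.^ m
    preimage-count a = ℤ.+-injective (begin
      + (N ℕ.* M ℕ.+ H ℕ.* (2 ℕ.* kₐ ℕ.+ 1))
        ≡⟨ ≡.cong +_ (solve 4 (λ N M H k → N :* M :+ H :* (con 2 :* k :+ con 1) := N :* M :+ k :* (H :+ H) :+ H)
                        ≡.refl N M H kₐ) ⟩
      + (N ℕ.* M) ℤ.+ + (kₐ ℕ.* (H ℕ.+ H)) ℤ.+ + H
        ≡⟨ ≡.cong₂ ℤ._+_ (≡.cong₂ ℤ._+_ (fourier-inversion (bent⇒Tr-nontrivial bent) a)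
             (≡.sym (length-filter-tabulate ℤ.+-0-commutativeMonoid (λ k → + (k ℕ.* (H ℕ.+ H))) (+ (H ℕ.+ H))
               ≡.refl (λ _ → ≡.refl) (counted? a) L.element)))
             (LP.sum-atZero (+ H)) ⟨
      sum (A ∘ L.element) ℤ.+ sum (B ∘ L.element) ℤ.+ sum (C ∘ L.element)
        ≡⟨ ≡.cong (ℤ._+ sum (C ∘ L.element)) (∑-distrib-+ (A ∘ L.element) (B ∘ L.element)) ⟨
      sum (λ j → A (L.element j) ℤ.+ B (L.element j)) ℤ.+ sum (C ∘ L.element)
        ≡⟨ ∑-distrib-+ (λ j → A (L.element j) ℤ.+ B (L.element j)) (C ∘ L.element) ⟨
      sum (λ j → A (L.element j) ℤ.+ B (L.element j) ℤ.+ C (L.element j))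
        ≡⟨ sum-cong-≗ (λ j → Wχ-balance a (L.element j)) ⟩
      sum (λ j → + H ℤ.+ D (L.element j))
        ≡⟨ ∑-distrib-+ {M} (const (+ H)) (D ∘ L.element) ⟩
      sum {M} (const (+ H)) ℤ.+ sum (D ∘ L.element)
        ≡⟨ ≡.cong₂ ℤ._+_ (≡.trans (sum-const-ℤ M (+ H)) (≡.sym (ℤ.pos-* M H))) (LP.sum-atZero (+ (2 ℕ.^ n))) ⟩
      + (M ℕ.* H ℕ.+ 2 ℕ.^ n)
        ≡⟨ ≡.cong +_ (≡.trans (ℕ.+-comm (M ℕ.* H) (2 ℕ.^ n)) (≡.cong (2 ℕ.^ n ℕ.+_) (ℕ.*-comm M H))) ⟩
      + (2 ℕ.^ n ℕ.+ H ℕ.* M) ∎)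
      where
      open ≡.≡-Reasoning
      open ℕ-Solver.+-*-Solver
      N  = ∣preimage∣ K L F a
      M  = 2 ℕ.^ m
      kₐ = k K L F h a
      A B C D : L.Carrier → ℤ
      A b = W b ℤ.* χ (a L.* b)
      B b = if does (counted? a b) then + (H ℕ.+ H) else ℤ.0ℤ
      C b = if does (b L.≟ L.0#) then + H else ℤ.0ℤ
      D b = if does (b L.≟ L.0#) then + (2 ℕ.^ n) else ℤ.0ℤ

    -- Parity of k_a.

    signOf : ∀ b → Dec (b L.≈ L.0#) → Parity
    -- The default 0 is forced at b = 0, which is never counted and where Tr(ab) = 0.
    signOf b (yes _)  = 0ℙ
    signOf b (no b≉0) = proj₁ (W≡±H b b≉0)

    sign : L.Carrier → Parity
    sign b = signOf b (b L.≟ L.0#)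

    counted-parity : ∀ a b (b≟0 : Dec (b L.≈ L.0#)) →
      (if does (counted? a b) then 1ℙ else 0ℙ) ≡ signOf b b≟0 ℙ.+ L.Tr (a L.* b)
    counted-parity a b (yes b≈0) = ≡.trans (if-no (counted? a b) λ c → proj₁ c b≈0)
      (≡.sym (≡.trans (LP.Tr-cong (L.trans (L.*-congˡ b≈0) (L.zeroʳ a))) LP.Tr-0))
    counted-parity a b (no b≉0) = byParity _ ≡.refl
      where
      W≡ = proj₂ (W≡±H b b≉0)

      byParity : ∀ p → signOf b (no b≉0) ℙ.+ L.Tr (a L.* b) ≡ p →
                 (if does (counted? a b) then 1ℙ else 0ℙ) ≡ p
      byParity 0ℙ e = if-no (counted? a b) (¬counted a b≉0 W≡ e)
      byParity 1ℙ e = if-yes (counted? a b) (counted a b≉0 W≡ e)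

    -- Mod 2, k_a = Σ sign b + Σ Tr (a b) = Σ sign b + Tr (a Σ b), and Σ b = 0.
    parity-k : 2 ≤ m → ∀ a → parity (k K L F h a) ≡ ℙSum.sum (sign ∘ L.element)
    parity-k 2≤m a = begin
      parity (k K L F h a)
        ≡⟨ length-filter-tabulate ℙ.+-0-commutativeMonoid parity 1ℙ ≡.refl
             (λ i → ≡.sym (ℙ.⁻¹-selfInverse (ℙ.suc-homo-⁻¹ i))) (counted? a) L.element ⟩
      ℙSum.sum (λ j → if does (counted? a (L.element j)) then 1ℙ else 0ℙ)
        ≡⟨ ℙSum.sum-cong-≗ (λ j → counted-parity a (L.element j) (L.element j L.≟ L.0#)) ⟩
      ℙSum.sum (λ j → sign (L.element j) ℙ.+ L.Tr (a L.* L.element j))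
        ≡⟨ ℙSum.∑-distrib-+ (sign ∘ L.element) (λ j → L.Tr (a L.* L.element j)) ⟩
      ℙSum.sum (sign ∘ L.element) ℙ.+ ℙSum.sum (λ j → L.Tr (a L.* L.element j))
        ≡⟨ ≡.cong (ℙSum.sum (sign ∘ L.element) ℙ.+_) sum-Tr≡0 ⟩
      ℙSum.sum (sign ∘ L.element) ℙ.+ 0ℙ
        ≡⟨ ℙ.+-identityʳ _ ⟩
      ℙSum.sum (sign ∘ L.element) ∎
      where
      open ≡.≡-Reasoning
      module LSum = SemiringSum L.semiring

      sum-Tr≡0 : ℙSum.sum (λ j → L.Tr (a L.* L.element j)) ≡ 0ℙ
      sum-Tr≡0 = ≡.trans (≡.sym (LP.Tr-sum (λ j → a L.* L.element j)))
        (≡.trans (LP.Tr-cong (L.trans (L.sym (LSum.*-distribˡ-sum a L.element))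
                   (L.trans (L.*-congˡ (LP.sum-element≈0 2≤m)) (L.zeroʳ a)))) LP.Tr-0)

open import Data.Rational.Base using (_+_; _-_; _*_)

theorem4p8 : ∀ {c₁ ℓ₁ c₂ ℓ₂} {n m : ℕ}
    (K : BinaryField c₁ ℓ₁ n) (L : BinaryField c₂ ℓ₂ m)
    (F : Func (BinaryField.setoid K) (BinaryField.setoid L)) →
    Bent K L F →
    Σ ℕ λ h → n ≡ 2 ℕ.* h ×
    (∀ (a : BinaryField.Carrier L) →
    fromℕ (∣preimage∣ K L F a)
    ≡ 2^ (+ n ℤ.- + m) + 2^ (+ h) - 2^ (+ h ℤ.- + m) * fromℕ (2 ℕ.* k K L F h a ℕ.+ 1)) ×
    (2 ≤ m → ∀ (a a′ : BinaryField.Carrier L) →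
    parity (k K L F h a) ≡ parity (k K L F h a′))
theorem4p8 {n = n} {m} K L F bent =
    h , n≡2h
  , (λ a → divide-by-2^m n h m (∣preimage∣ K L F a) (2 ℕ.* k K L F h a ℕ.+ 1)
             (preimage-count K L F bent {h} n≡2h a))
  , (λ 2≤m a a′ → ≡.trans (parity-k K L F bent {h} n≡2h 2≤m a)
                          (≡.sym (parity-k K L F bent {h} n≡2h 2≤m a′)))
  where
  module L = BinaryField L

  -- Any nonzero b would show that 2ⁿ is a square; 1 is one that every field provides.
  sqrt : ∃ λ h → n ≡ 2 ℕ.* h × ∣ W K L F L.1# ∣ ≡ 2 ℕ.^ h
  sqrt = square≡2^n n ∣ W K L F L.1# ∣ (bent L.1# (L.0≉1 ∘ L.sym) (BinaryField.0# K))

  h : ℕ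
  h = proj₁ sqrt

  n≡2h : n ≡ 2 ℕ.* h
  n≡2h = proj₁ (proj₂ sqrt)
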